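{- For every integer $m\geq 0$ and every integer $r\geq 3$, $$\operatorname{forb}(m,r,M)\leq\left(1+\tfrac{83}{192}\right)m(r-1)^{m-1}+(r-1)^m.$$
   Context: An $r$-matrix is a matrix with entries in $\{0,1,\dots,r-1\}$; it is simple if its columns are pairwise distinct. A matrix $A$ contains a configuration of $F$ if some submatrix of $A$ is a row and column permutation of $F$. Let $M=\begin{bmatrix}0&1\\0&1\\1&0\end{bmatrix}$, and let $\operatorname{forb}(m,r,M)$ be the maximum number of columns of an $m$-rowed simple $r$-matrix containing no configuration of $M$. -}

module Defs where

open import Data.Nat using (ℕ; zero; suc; _+_; _*_; _∸_; _^_; _≤_)
open import Data.Fin using (Fin; zero; suc; toℕ)
open import Data.Product using (Σ; _×_; ∃)
open import Function.Definitions using (Injective)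
open import Relation.Binary.PropositionalEquality using (_≡_)
open import Relation.Nullary using (¬_)

Matrix : ℕ → ℕ → ℕ → Set
Matrix m n r = Fin m → Fin n → Fin r

Simple : ∀ {m n r} → Matrix m n r → Set
Simple {m} {n} A = ∀ (j k : Fin n) → (∀ (i : Fin m) → A i j ≡ A i k) → j ≡ k

M : Fin 3 → Fin 2 → ℕ
M zero          zero       = 0
M zero          (suc zero) = 1
M (suc zero)    zero       = 0
M (suc zero)    (suc zero) = 1
M (suc (suc zero)) zero       = 1
M (suc (suc zero)) (suc zero) = 0

-- A contains a configuration of F (a p×q matrix) iff there are injective row
-- and column selections (ordered, hence covering all row/column permutations)
-- such that the selected submatrix equals F entrywise.
ContainsConfig : ∀ {m n r p q} → Matrix m n r → (Fin p → Fin q → ℕ) → Set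
ContainsConfig {m} {n} {r} {p} {q} A F =
  Σ (Fin p → Fin m) λ ρ → Σ (Fin q → Fin n) λ γ →
    Injective _≡_ _≡_ ρ × Injective _≡_ _≡_ γ ×
    (∀ (a : Fin p) (b : Fin q) → toℕ (A (ρ a) (γ b)) ≡ F a b)

-- forb(m,r,M) ≤ bound  unfolds to: every simple m-rowed r-matrix avoiding M
-- has at most `bound` columns.  The bound (1 + 83/192) m (r-1)^(m-1) + (r-1)^m
-- is multiplied through by 192 to stay in ℕ (for m = 0 the first term is 0).

{-# OPTIONS --safe #-}
-- Read the columns as words and compress the family row by row: in the current row replace the two
-- subfamilies starting with 0 and 1 by their union (coded 0) and their intersection (coded 1).  This keeps
-- the number of words, and a compressed word with 1s in a set X of rows certifies that X is shattered by
-- the original family inside one pattern of symbols ≥ 2.  Since M is avoided, no three rows are shattered.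
-- With R = r - 1, words with at most one 1 number at most R^m + m R^(m-1), so it remains to bound the words
-- with exactly two 1s.
--
-- Call (x, y; z) good if some compressed word has 1 in rows x, y and 0 in row z.  Avoidance of M implies that
-- at most one of the three pairs in a triple of rows is good with respect to the third row.  If b(x, y) is
-- the number of bad z, then at most R^(m-2-b) (R-1)^b compressed words have their 1s in x and y.  For each k,
-- let d_x be the degree of x in the graph of the pairs with b < k.  Counting bad triples against paths of length
-- two gives 3 ∑ b ≥ ∑ d_x (d_x - 1), with b summed over the edges, whence 48 ∑ (k - b)⁺ ≤ m (3k + 2)² over all pairs.  Finally
-- b ↦ R^(m-2-b) (R-1)^b is convex, so it is a positive combination of the functions (k - b)⁺, and the
-- corresponding combination of the squares (3k + 2)² evaluates to at most the required constant.
module Submission where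

open import Defs
open import Data.Nat using (ℕ; _+_; _*_; _∸_; _^_; _≤_)
open import Relation.Nullary using (¬_)
open import Data.Nat using (zero; suc; z≤n; s≤s; _<ᵇ_; _≤?_)
open import Data.Nat.Properties
open import Data.Nat.Tactic.RingSolver using (solve-∀)
open import Data.Bool using (Bool; true; false; not; _∧_; _∨_; if_then_else_; T)
open import Data.Bool.Properties using (not-¬; not-involutive)
open import Data.Fin as Fin using (Fin; zero; suc; toℕ)
import Data.Fin.Properties as Fin
open import Data.Vec using (Vec; []; _∷_; lookup)
open import Data.Product using (∃; _×_; _,_; proj₁; proj₂)
open import Data.Sum using ([_,_]′)
open import Data.Empty using (⊥-elim)
open import Function using (_∘_; mk⇔)
open import Function.Definitions using (Injective)
open import Relation.Binary using (tri<; tri≈; tri>)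
open import Relation.Binary.PropositionalEquality
open import Relation.Nullary using (Dec; yes; no; does; contradiction)
open import Relation.Nullary.Decidable
  using (_×-dec_; _→-dec_; ¬?; T?; map′; dec-true; dec-false; does-⇔; from-yes)
open import Algebra.Properties.Semiring.Sum +-*-semiring
  using (sum; sum-syntax; sum-cong-≗; ∑-distrib-+; ∑-comm; *-distribˡ-sum; *-distribʳ-sum; sum-replicate-zero)
open import Algebra.Properties.CommutativeMonoid.Sum *-1-commutativeMonoid
  using () renaming (sum to product; sum-cong-≗ to product-cong)

-- Sums over words

𝟙 : Bool → ℕ
𝟙 b = if b then 1 else 0

sum-mono : ∀ {n} {f g : Fin n → ℕ} → (∀ i → f i ≤ g i) → sum f ≤ sum g
sum-mono {zero}  f≤g = z≤n
sum-mono {suc n} f≤g = +-mono-≤ (f≤g zero) (sum-mono (f≤g ∘ suc))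

sum-const : ∀ n (c : ℕ) → ∑[ i < n ] c ≡ n * c
sum-const zero    c = refl
sum-const (suc n) c = cong (c +_) (sum-const n c)

term≤sum : ∀ {n} (f : Fin n → ℕ) i → f i ≤ sum f
term≤sum f zero    = m≤m+n _ _
term≤sum f (suc i) = m≤n⇒m≤o+n _ (term≤sum (f ∘ suc) i)

two-terms≤sum : ∀ {n} (f : Fin n → ℕ) {i j} → i ≢ j → f i + f j ≤ sum f
two-terms≤sum f {zero}  {zero}  i≢j = contradiction refl i≢j
two-terms≤sum f {zero}  {suc j} i≢j = +-monoʳ-≤ _ (term≤sum (f ∘ suc) j)
two-terms≤sum f {suc i} {zero}  i≢j =
  subst (_≤ sum f) (+-comm (f zero) _) (+-monoʳ-≤ _ (term≤sum (f ∘ suc) i))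
two-terms≤sum f {suc i} {suc j} i≢j =
  m≤n⇒m≤o+n _ (two-terms≤sum (f ∘ suc) (i≢j ∘ cong suc))

sum-𝟙-≟ : ∀ {n} (i : Fin n) → ∑[ j < n ] 𝟙 (does (i Fin.≟ j)) ≡ 1
sum-𝟙-≟ {suc n} zero    = cong suc (sum-replicate-zero n)
sum-𝟙-≟ {suc n} (suc i) = sum-𝟙-≟ i

product≡1 : ∀ {n} {f : Fin n → ℕ} → (∀ i → f i ≡ 1) → product f ≡ 1
product≡1 {zero}  f≡1 = refl
product≡1 {suc n} {f} f≡1 rewrite f≡1 zero = trans (+-identityʳ _) (product≡1 (f≡1 ∘ suc))

product-const : ∀ n (c : ℕ) → product {n} (λ _ → c) ≡ c ^ n
product-const zero    c = refl
product-const (suc n) c = cong (c *_) (product-const n c)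

product-single : ∀ {n} (c : ℕ) (i : Fin (suc n)) →
                 product (λ j → if does (i Fin.≟ j) then 1 else c) ≡ c ^ n
product-single {n}     c zero    = trans (+-identityʳ _) (product-const n c)
product-single {suc n} c (suc i) = cong (c *_) (product-single c i)

module _ {r : ℕ} where

  sumW : ∀ {m} → (Vec (Fin r) m → ℕ) → ℕ
  sumW {zero}  f = f []
  sumW {suc m} f = ∑[ s < r ] sumW (λ w → f (s ∷ w))

  sumW-cong : ∀ {m} {f g : Vec (Fin r) m → ℕ} → (∀ w → f w ≡ g w) → sumW f ≡ sumW g
  sumW-cong {zero}  f≡g = f≡g []
  sumW-cong {suc m} f≡g = sum-cong-≗ λ s → sumW-cong λ w → f≡g (s ∷ w)

  sumW-mono : ∀ {m} {f g : Vec (Fin r) m → ℕ} → (∀ w → f w ≤ g w) → sumW f ≤ sumW g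
  sumW-mono {zero}  f≤g = f≤g []
  sumW-mono {suc m} f≤g = sum-mono λ s → sumW-mono λ w → f≤g (s ∷ w)

  sumW-+ : ∀ {m} (f g : Vec (Fin r) m → ℕ) → sumW (λ w → f w + g w) ≡ sumW f + sumW g
  sumW-+ {zero}  f g = refl
  sumW-+ {suc m} f g =
    trans (sum-cong-≗ λ s → sumW-+ (λ w → f (s ∷ w)) (λ w → g (s ∷ w)))
          (∑-distrib-+ {r} _ _)

  sumW-* : ∀ {m} c (f : Vec (Fin r) m → ℕ) → sumW (λ w → c * f w) ≡ c * sumW f
  sumW-* {zero}  c f = refl
  sumW-* {suc m} c f =
    trans (sum-cong-≗ λ s → sumW-* c (λ w → f (s ∷ w)))
          (sym (*-distribˡ-sum c (λ s → sumW (λ w → f (s ∷ w)))))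

  sumW-∑ : ∀ {m n} (f : Fin n → Vec (Fin r) m → ℕ) →
           sumW (λ w → ∑[ i < n ] f i w) ≡ ∑[ i < n ] sumW (f i)
  sumW-∑ {zero}      f = refl
  sumW-∑ {suc m} {n} f =
    trans (sum-cong-≗ λ s → sumW-∑ (λ i w → f i (s ∷ w)))
          (∑-comm (λ s i → sumW (λ w → f i (s ∷ w))))

  -- Expanding the product of the row sums picks one symbol per row. For 0/1-valued `t` this counts
  -- the words of a box.
  sumW-product : ∀ {m} (t : Fin m → Fin r → ℕ) →
                 sumW (λ w → product (λ z → t z (lookup w z))) ≡ product (λ z → ∑[ s < r ] t z s)
  sumW-product {zero}  t = refl
  sumW-product {suc m} t =
    trans (sum-cong-≗ λ s → trans (sumW-* {m} (t zero s) (λ w → product (λ z → t (suc z) (lookup w z))))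
                                  (cong (t zero s *_) (sumW-product (t ∘ suc))))
          (sym (*-distribʳ-sum _ (t zero)))

  any-word? : ∀ {m} {P : Vec (Fin r) m → Set} → (∀ w → Dec (P w)) → Dec (∃ P)
  any-word? {zero}  P? = map′ ([] ,_) (λ { ([] , p) → p }) (P? [])
  any-word? {suc m} P? = map′ (λ { (s , w , p) → s ∷ w , p }) (λ { (s ∷ w , p) → s , w , p })
                              (Fin.any? λ s → any-word? λ w → P? (s ∷ w))

-- Compression and shattering

module _ {a : ℕ} where

  private
    Word : ℕ → Set
    Word m = Vec (Fin (2 + a)) m

  bit : Bool → Fin (2 + a)
  bit false = zero
  bit true  = suc zero

  compress : ∀ {m} → (Word m → Bool) → Word m → Bool
  compress χ []                = χ []
  compress χ (zero ∷ ω)        = compress (λ w → χ (zero ∷ w) ∨ χ (suc zero ∷ w)) ω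
  compress χ (suc zero ∷ ω)    = compress (λ w → χ (zero ∷ w) ∧ χ (suc zero ∷ w)) ω
  compress χ (suc (suc s) ∷ ω) = compress (λ w → χ (suc (suc s) ∷ w)) ω

  size : ∀ {m} → (Word m → Bool) → ℕ
  size χ = sumW (𝟙 ∘ χ)

  𝟙-∨-∧ : ∀ b c → 𝟙 (b ∨ c) + 𝟙 (b ∧ c) ≡ 𝟙 b + 𝟙 c
  𝟙-∨-∧ false c     = +-identityʳ _
  𝟙-∨-∧ true  false = refl
  𝟙-∨-∧ true  true  = refl

  -- In each row the exchange preserves cardinality: a union and an intersection together have the
  -- size of the two sets.
  size-compress : ∀ {m} (χ : Word m → Bool) → size (compress χ) ≡ size χ
  size-compress {zero}  χ = refl
  size-compress {suc m} χ = begin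
    size (compress χ₀∨χ₁) + (size (compress χ₀∧χ₁) + _)
      ≡⟨ cong₂ _+_ (size-compress χ₀∨χ₁)
           (cong₂ _+_ (size-compress χ₀∧χ₁) (sum-cong-≗ λ s → size-compress (λ w → χ (suc (suc s) ∷ w)))) ⟩
    size χ₀∨χ₁ + (size χ₀∧χ₁ + rest)  ≡⟨ +-assoc (size χ₀∨χ₁) _ _ ⟨
    size χ₀∨χ₁ + size χ₀∧χ₁ + rest    ≡⟨ cong (_+ rest) exchange ⟩
    size χ₀ + size χ₁ + rest          ≡⟨ +-assoc (size χ₀) _ _ ⟩
    size χ₀ + (size χ₁ + rest)        ∎
    where
    open ≡-Reasoning
    χ₀ χ₁ χ₀∨χ₁ χ₀∧χ₁ : Word m → Bool
    χ₀ w = χ (zero ∷ w)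
    χ₁ w = χ (suc zero ∷ w)
    χ₀∨χ₁ w = χ₀ w ∨ χ₁ w
    χ₀∧χ₁ w = χ₀ w ∧ χ₁ w
    rest = ∑[ s < a ] size (λ w → χ (suc (suc s) ∷ w))
    exchange : size χ₀∨χ₁ + size χ₀∧χ₁ ≡ size χ₀ + size χ₁
    exchange = trans (sym (sumW-+ (𝟙 ∘ χ₀∨χ₁) (𝟙 ∘ χ₀∧χ₁)))
              (trans (sumW-cong λ w → 𝟙-∨-∧ (χ₀ w) (χ₁ w)) (sumW-+ (𝟙 ∘ χ₀) (𝟙 ∘ χ₁)))

  choose : ∀ {m} → (Word (suc m) → Bool) → Word m → Bool
  choose χ w = not (χ (zero ∷ w))

  choose-∈ : ∀ {m} (χ : Word (suc m) → Bool) w →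
             T (χ (zero ∷ w) ∨ χ (suc zero ∷ w)) → T (χ (bit (choose χ w) ∷ w))
  choose-∈ χ w p with χ (zero ∷ w) in eq
  ... | true  = subst T (sym eq) _
  ... | false = p

  both-∈ : ∀ {m} (χ : Word (suc m) → Bool) w b →
           T (χ (zero ∷ w) ∧ χ (suc zero ∷ w)) → T (χ (bit b ∷ w))
  both-∈ χ w b p with χ (zero ∷ w) in eq
  both-∈ χ w false p | true = subst T (sym eq) _
  both-∈ χ w true  p | true = p

  -- The word of χ with prescribed values c at the rows where ω is 1.  The union at a row with code 0 is taken before
  -- the later rows are processed, so a row's symbol depends on the values at later rows, never on earlier ones.
  shatter : ∀ {m} → (Word m → Bool) → Word m → (Fin m → Bool) → Word m
  shatter χ []                c = []
  shatter χ (zero ∷ ω)        c = bit (choose χ w) ∷ w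
    where w = shatter (λ w → χ (zero ∷ w) ∨ χ (suc zero ∷ w)) ω (c ∘ suc)
  shatter χ (suc zero ∷ ω)    c =
    bit (c zero) ∷ shatter (λ w → χ (zero ∷ w) ∧ χ (suc zero ∷ w)) ω (c ∘ suc)
  shatter χ (suc (suc s) ∷ ω) c =
    suc (suc s) ∷ shatter (λ w → χ (suc (suc s) ∷ w)) ω (c ∘ suc)

  shatter-∈ : ∀ {m} (χ : Word m → Bool) ω c → T (compress χ ω) → T (χ (shatter χ ω c))
  shatter-∈ χ []                c p = p
  shatter-∈ χ (zero ∷ ω)        c p = choose-∈ χ _ (shatter-∈ _ ω (c ∘ suc) p)
  shatter-∈ χ (suc zero ∷ ω)    c p = both-∈ χ _ (c zero) (shatter-∈ _ ω (c ∘ suc) p)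
  shatter-∈ χ (suc (suc s) ∷ ω) c p = shatter-∈ (λ w → χ (suc (suc s) ∷ w)) ω (c ∘ suc) p

  shatter-one : ∀ {m} (χ : Word m → Bool) ω c i → lookup ω i ≡ suc zero →
                lookup (shatter χ ω c) i ≡ bit (c i)
  shatter-one χ (suc zero ∷ ω)    c zero    eq = refl
  shatter-one χ (zero ∷ ω)        c (suc i) eq = shatter-one _ ω (c ∘ suc) i eq
  shatter-one χ (suc zero ∷ ω)    c (suc i) eq = shatter-one _ ω (c ∘ suc) i eq
  shatter-one χ (suc (suc s) ∷ ω) c (suc i) eq = shatter-one _ ω (c ∘ suc) i eq

  shatter-zero : ∀ {m} (χ : Word m → Bool) ω c i → lookup ω i ≡ zero →
                 ∃ λ b → lookup (shatter χ ω c) i ≡ bit b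
  shatter-zero χ (zero ∷ ω)        c zero    eq = _ , refl
  shatter-zero χ (zero ∷ ω)        c (suc i) eq = shatter-zero _ ω (c ∘ suc) i eq
  shatter-zero χ (suc zero ∷ ω)    c (suc i) eq = shatter-zero _ ω (c ∘ suc) i eq
  shatter-zero χ (suc (suc s) ∷ ω) c (suc i) eq = shatter-zero _ ω (c ∘ suc) i eq

  shatter-cong : ∀ {m} (χ : Word m → Bool) ω {c d} → (∀ j → c j ≡ d j) → shatter χ ω c ≡ shatter χ ω d
  shatter-cong χ []                c≡d = refl
  shatter-cong χ (zero ∷ ω)        c≡d = cong (λ w → bit (choose χ w) ∷ w) (shatter-cong _ ω (c≡d ∘ suc))
  shatter-cong χ (suc zero ∷ ω)    c≡d = cong₂ (λ b → bit b ∷_) (c≡d zero) (shatter-cong _ ω (c≡d ∘ suc))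
  shatter-cong χ (suc (suc s) ∷ ω) c≡d = cong (suc (suc s) ∷_) (shatter-cong _ ω (c≡d ∘ suc))

  -- The recursion drops the value of `c` at each row it passes, and the family it passes on does
  -- not depend on `c`, so at row `i` only the values from `i` on remain.
  shatter-local : ∀ {m} (χ : Word m → Bool) ω {c d} i → (∀ j → i Fin.≤ j → c j ≡ d j) →
                  lookup (shatter χ ω c) i ≡ lookup (shatter χ ω d) i
  shatter-local χ ω                 zero    c≡d = cong (λ w → lookup w zero) (shatter-cong χ ω (λ j → c≡d j z≤n))
  shatter-local χ (zero ∷ ω)        (suc i) c≡d = shatter-local _ ω i (λ j i≤j → c≡d (suc j) (s≤s i≤j))
  shatter-local χ (suc zero ∷ ω)    (suc i) c≡d = shatter-local _ ω i (λ j i≤j → c≡d (suc j) (s≤s i≤j))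
  shatter-local χ (suc (suc s) ∷ ω) (suc i) c≡d = shatter-local _ ω i (λ j i≤j → c≡d (suc j) (s≤s i≤j))

  bit-injective : ∀ {b c} → bit b ≡ bit c → b ≡ c
  bit-injective {false} {false} _ = refl
  bit-injective {true}  {true}  _ = refl

  -- Families of words that avoid the configuration

  infix 4 _at_≡_,_,_
  _at_≡_,_,_ : ∀ {m} → Word m → Fin m × Fin m × Fin m → Bool → Bool → Bool → Set
  w at (x , y , z) ≡ α , β , γ = lookup w x ≡ bit α × lookup w y ≡ bit β × lookup w z ≡ bit γ

  Avoids : ∀ {m} → (Word m → Bool) → Set
  Avoids {m} χ = ∀ (u v : Word m) {x y z : Fin m} → T (χ u) → T (χ v) → x ≢ y → x ≢ z → y ≢ z →
    u at (x , y , z) ≡ false , false , true → ¬ (v at (x , y , z) ≡ true , true , false)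

  mark : ∀ {m} → Fin m → Fin m → Bool → Bool → Fin m → Bool
  mark x y α β j = if does (x Fin.≟ j) then α else if does (y Fin.≟ j) then β else false

  mark-fst : ∀ {m} (x y : Fin m) {α β} → mark x y α β x ≡ α
  mark-fst x y rewrite dec-true (x Fin.≟ x) refl = refl

  mark-snd : ∀ {m} {x y : Fin m} {α β} → x ≢ y → mark x y α β y ≡ β
  mark-snd {x = x} {y} x≢y rewrite dec-false (x Fin.≟ y) x≢y | dec-true (y Fin.≟ y) refl = refl

  mark-other : ∀ {m} {x y : Fin m} {α α′ β} j → x ≢ j → mark x y α β j ≡ mark x y α′ β j
  mark-other {x = x} j x≢j rewrite dec-false (x Fin.≟ j) x≢j = refl

  module _ {m} {χ : Word m → Bool} (avoids : Avoids χ) where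

    -- A nonconstant pattern on three rows singles out one row. Moving this row last and ordering
    -- the two words turns the pattern and its complement into the columns of `M`.
    no-complement : ∀ {u v x y z} → T (χ u) → T (χ v) → x ≢ y → x ≢ z → y ≢ z →
      ∀ α β γ → ¬ (α ≡ β × β ≡ γ) →
      u at (x , y , z) ≡ α , β , γ → ¬ (v at (x , y , z) ≡ not α , not β , not γ)
    no-complement u∈ v∈ x≢y x≢z y≢z false false false ¬c _ _ = ¬c (refl , refl)
    no-complement u∈ v∈ x≢y x≢z y≢z true  true  true  ¬c _ _ = ¬c (refl , refl)
    no-complement u∈ v∈ x≢y x≢z y≢z false false true  _ = avoids _ _ u∈ v∈ x≢y x≢z y≢z
    no-complement u∈ v∈ x≢y x≢z y≢z true  true  false _ u v = avoids _ _ v∈ u∈ x≢y x≢z y≢z v u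
    no-complement u∈ v∈ x≢y x≢z y≢z false true  false _ (ux , uy , uz) (vx , vy , vz) =
      avoids _ _ u∈ v∈ x≢z x≢y (≢-sym y≢z) (ux , uz , uy) (vx , vz , vy)
    no-complement u∈ v∈ x≢y x≢z y≢z true  false true  _ (ux , uy , uz) (vx , vy , vz) =
      avoids _ _ v∈ u∈ x≢z x≢y (≢-sym y≢z) (vx , vz , vy) (ux , uz , uy)
    no-complement u∈ v∈ x≢y x≢z y≢z true  false false _ (ux , uy , uz) (vx , vy , vz) =
      avoids _ _ u∈ v∈ y≢z (≢-sym x≢y) (≢-sym x≢z) (uy , uz , ux) (vy , vz , vx)
    no-complement u∈ v∈ x≢y x≢z y≢z false true  true  _ (ux , uy , uz) (vx , vy , vz) =
      avoids _ _ v∈ u∈ y≢z (≢-sym x≢y) (≢-sym x≢z) (vy , vz , vx) (uy , uz , ux)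

    -- Three 1s would shatter three rows, so the complementary values `c` and `not ∘ c`, with `c`
    -- singling out `z`, would produce both columns of `M`.
    no-three-ones : ∀ {ω x y z} → T (compress χ ω) → x ≢ y → x ≢ z → y ≢ z →
      lookup ω x ≡ suc zero → lookup ω y ≡ suc zero → lookup ω z ≢ suc zero
    no-three-ones {ω} {x} {y} {z} p x≢y x≢z y≢z ωx ωy ωz =
      avoids _ _ (shatter-∈ χ ω c p) (shatter-∈ χ ω (not ∘ c) p) x≢y x≢z y≢z
        ( at c ωx (dec-false (z Fin.≟ x) (≢-sym x≢z))
        , at c ωy (dec-false (z Fin.≟ y) (≢-sym y≢z))
        , at c ωz (dec-true (z Fin.≟ z) refl))
        ( at (not ∘ c) ωx (cong not (dec-false (z Fin.≟ x) (≢-sym x≢z)))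
        , at (not ∘ c) ωy (cong not (dec-false (z Fin.≟ y) (≢-sym y≢z)))
        , at (not ∘ c) ωz (cong not (dec-true (z Fin.≟ z) refl)))
      where
      c : Fin m → Bool
      c j = does (z Fin.≟ j)
      at : ∀ d {i b} → lookup ω i ≡ suc zero → d i ≡ b → lookup (shatter χ ω d) i ≡ bit b
      at d {i} ωi refl = shatter-one χ ω d i ωi

    Good : Fin m → Fin m → Fin m → Set
    Good x y z = ∃ λ ω → T (compress χ ω) × lookup ω x ≡ suc zero × lookup ω y ≡ suc zero × lookup ω z ≡ zero

    Good-sym : ∀ {x y z} → Good x y z → Good y x z
    Good-sym (ω , p , ωx , ωy , ωz) = ω , p , ωy , ωx , ωz

    Good-shatters : ∀ {x y z} → Good x y z → x ≢ y →
      ∀ α β → ∃ λ w → T (χ w) × ∃ λ γ → w at (x , y , z) ≡ α , β , γ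
    Good-shatters {x} {y} {z} (ω , p , ωx , ωy , ωz) x≢y α β =
      let c = mark x y α β
          γ , wz = shatter-zero χ ω c z ωz
      in shatter χ ω c , shatter-∈ χ ω c p , γ ,
         trans (shatter-one χ ω c x ωx) (cong bit (mark-fst x y)) ,
         trans (shatter-one χ ω c y ωy) (cong bit (mark-snd x≢y)) , wz

    -- One symbol `γ` at `z` serves all four patterns on `x`, `y`, whereas in `Good-shatters` it may
    -- vary with the pattern.
    Cylinder : Fin m → Fin m → Fin m → Set
    Cylinder x y z = ∃ λ γ → ∀ α β → ∃ λ w → T (χ w) × w at (x , y , z) ≡ α , β , γ

    -- Row z comes after x, so the symbol chosen there depends on the value at y only; and the words with values
    -- 10 and 01 at x, y must agree at z.
    Good-cylinder : ∀ {x y z} → Good x y z → x ≢ y → x ≢ z → y ≢ z → x Fin.< z → Cylinder x y z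
    Good-cylinder {x} {y} {z} g@(ω , p , ωx , ωy , ωz) x≢y x≢z y≢z x<z = f true false , cyl
      where
      w : Bool → Bool → Word m
      w α β = shatter χ ω (mark x y α β)
      f : Bool → Bool → Bool
      f α β = proj₁ (shatter-zero χ ω (mark x y α β) z ωz)
      f-spec : ∀ α β → w α β at (x , y , z) ≡ α , β , f α β
      f-spec α β =
         trans (shatter-one χ ω _ x ωx) (cong bit (mark-fst x y)) ,
         trans (shatter-one χ ω _ y ωy) (cong bit (mark-snd x≢y)) ,
         proj₂ (shatter-zero χ ω (mark x y α β) z ωz)
      f-fst : ∀ α α′ β → f α β ≡ f α′ β
      f-fst α α′ β = bit-injective (trans (sym (proj₂ (proj₂ (f-spec α β))))
        (trans (shatter-local χ ω z λ j z≤j → mark-other {x = x} {y} {α} {α′} {β} j λ { refl → <⇒≱ x<z z≤j })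
               (proj₂ (proj₂ (f-spec α′ β)))))
      f-diag : f true false ≡ f false true
      f-diag with f true false | f false true | f-spec true false | f-spec false true
      ... | false | false | _ | _ = refl
      ... | true  | true  | _ | _ = refl
      ... | false | true  | u | v =
        ⊥-elim (no-complement (shatter-∈ χ ω _ p) (shatter-∈ χ ω _ p) x≢y x≢z y≢z true false false (λ ()) u v)
      ... | true  | false | u | v =
        ⊥-elim (no-complement (shatter-∈ χ ω _ p) (shatter-∈ χ ω _ p) x≢y x≢z y≢z true false true (λ ()) u v)
      f-const : ∀ α β → f α β ≡ f true false
      f-const α false = f-fst α true false
      f-const α true  = trans (f-fst α false true) (sym f-diag)
      cyl : ∀ α β → ∃ λ w → T (χ w) × w at (x , y , z) ≡ α , β , f true false
      cyl α β = w α β , shatter-∈ χ ω _ p ,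
        subst (w α β at (x , y , z) ≡ α , β ,_) (f-const α β) (f-spec α β)

    -- With `γ` the symbol of the cylinder, `Good x z y` yields a word with `γ` at `x`, `not γ` at
    -- `z` and some `β` at `y`. The cylinder supplies the complement on these rows, and the pattern
    -- is not constant as `x` and `z` differ.
    Cylinder-clash : ∀ {x y z} → x ≢ y → x ≢ z → y ≢ z → Cylinder x y z → ¬ Good x z y
    Cylinder-clash x≢y x≢z y≢z (γ , cyl) g =
      let u , u∈ , β , ux , uz , uy = Good-shatters g x≢z γ (not γ)
          v , v∈ , vx , vy , vz     = cyl (not γ) (not β)
      in no-complement u∈ v∈ x≢y x≢z y≢z γ β (not γ) (λ { (γ≡β , β≡nγ) → not-¬ {γ} refl (trans γ≡β β≡nγ) })
           (ux , uy , uz) (vx , vy , trans vz (cong bit (sym (not-involutive γ))))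

    Cylinder-swap : ∀ {x y z} → Cylinder y x z → Cylinder x y z
    Cylinder-swap (γ , cyl) = γ , λ α β → let w , w∈ , wy , wx , wz = cyl β α in w , w∈ , wx , wy , wz

    -- The later of `y` and `z` is the third row of one of the two triples and follows a row of its
    -- pair, so that triple is a cylinder and clashes with the other.
    Good-exclusive : ∀ {x y z} → x ≢ y → x ≢ z → y ≢ z → Good x y z → ¬ Good x z y
    Good-exclusive {x} {y} {z} x≢y x≢z y≢z g h with Fin.<-cmp y z
    ... | tri≈ _ y≡z _ = y≢z y≡z
    ... | tri< y<z _ _ = Cylinder-clash x≢y x≢z y≢z
          (Cylinder-swap (Good-cylinder (Good-sym g) (≢-sym x≢y) y≢z x≢z y<z)) h
    ... | tri> _ _ z<y = Cylinder-clash x≢z x≢y (≢-sym y≢z)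
          (Cylinder-swap (Good-cylinder (Good-sym h) (≢-sym x≢z) (≢-sym y≢z) x≢y z<y)) g

-- Counting bad triples

∀-Bool? : {P : Bool → Set} → (∀ b → Dec (P b)) → Dec (∀ b → P b)
∀-Bool? P? = map′ (λ { (f , t) false → f ; (f , t) true → t }) (λ p → p false , p true)
                  (P? false ×-dec P? true)

-- `p`, `q`, `s` tell which pairs of a triple are near, and `e`, `f`, `g` which are good. Two near
-- pairs give 2 against at least 3, three give 6 against at least 6.
TriangleBound : (p q s e f g : Bool) → Set
TriangleBound p q s e f g =
  T (not (e ∧ f) ∧ not (f ∧ g) ∧ not (g ∧ e)) →
  2 * (𝟙 p * 𝟙 s + (𝟙 q * 𝟙 p + 𝟙 s * 𝟙 q)) ≤
  3 * (𝟙 p * 𝟙 (not e) + (𝟙 q * 𝟙 (not f) + 𝟙 s * 𝟙 (not g)))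

triangle-bound? : Dec (∀ p q s e f g → TriangleBound p q s e f g)
triangle-bound? = ∀-Bool? λ p → ∀-Bool? λ q → ∀-Bool? λ s → ∀-Bool? λ e → ∀-Bool? λ f → ∀-Bool? λ g →
  T? _ →-dec (_ ≤? _)

-- Six Booleans leave 64 cases, settled by evaluating the decision procedure.
triangle-bound : ∀ p q s e f g → TriangleBound p q s e f g
triangle-bound = from-yes triangle-bound?

∑³ : ∀ {m} → (Fin m → Fin m → Fin m → ℕ) → ℕ
∑³ {m} f = ∑[ x < m ] ∑[ y < m ] ∑[ z < m ] f x y z

∑³-mono : ∀ {m} {f g : Fin m → Fin m → Fin m → ℕ} → (∀ x y z → f x y z ≤ g x y z) → ∑³ f ≤ ∑³ g
∑³-mono f≤g = sum-mono λ x → sum-mono λ y → sum-mono (f≤g x y)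

∑³-+ : ∀ {m} (f g : Fin m → Fin m → Fin m → ℕ) →
       ∑³ (λ x y z → f x y z + g x y z) ≡ ∑³ f + ∑³ g
∑³-+ {m} f g = trans
  (sum-cong-≗ λ x → trans (sum-cong-≗ λ y → ∑-distrib-+ (f x y) (g x y)) (∑-distrib-+ {m} _ _))
  (∑-distrib-+ {m} _ _)

∑³-rotate : ∀ {m} (f : Fin m → Fin m → Fin m → ℕ) → ∑³ (λ x y z → f y z x) ≡ ∑³ f
∑³-rotate {m} f = trans (∑-comm {m} {m} λ x y → ∑[ z < m ] f y z x)
                        (sum-cong-≗ λ y → ∑-comm λ x z → f y z x)

-- Rotating the triple leaves `∑³` unchanged, so summing the hypothesis gives three times the claim.
∑³-cyclic-≤ : ∀ {m} {f g : Fin m → Fin m → Fin m → ℕ} →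
  (∀ x y z → f x y z + (f y z x + f z x y) ≤ g x y z + (g y z x + g z x y)) → ∑³ f ≤ ∑³ g
∑³-cyclic-≤ {f = f} {g} f≤g =
  *-cancelˡ-≤ 3 (subst₂ _≤_ (cyclic f) (cyclic g) (∑³-mono f≤g))
  where
  cyclic : ∀ f → ∑³ (λ x y z → f x y z + (f y z x + f z x y)) ≡ 3 * ∑³ f
  cyclic f = begin
    ∑³ (λ x y z → f x y z + (f y z x + f z x y))
      ≡⟨ ∑³-+ f _ ⟩
    ∑³ f + ∑³ (λ x y z → f y z x + f z x y)
      ≡⟨ cong (∑³ f +_) (∑³-+ (λ x y z → f y z x) (λ x y z → f z x y)) ⟩
    ∑³ f + (∑³ (λ x y z → f y z x) + ∑³ (λ x y z → f z x y))
      ≡⟨ cong₂ (λ s t → ∑³ f + (s + t)) (∑³-rotate f)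
           (trans (sym (∑³-rotate λ x y z → f z x y)) (sym (+-identityʳ _))) ⟩
    3 * ∑³ f ∎
    where open ≡-Reasoning

distinct : ∀ {m} → Fin m → Fin m → Bool
distinct x y = not (does (x Fin.≟ y))

distinct-sym : ∀ {m} (x y : Fin m) → distinct x y ≡ distinct y x
distinct-sym x y = cong not (does-⇔ (mk⇔ sym sym) (x Fin.≟ y) (y Fin.≟ x))

-- The sides differ by the square of t - s; ordering the two numbers first keeps the difference in
-- ℕ.
2st≤s²+t² : ∀ s t → 2 * (s * t) ≤ s * s + t * t
2st≤s²+t² s t = [ ordered s t
                , (λ t≤s → subst₂ _≤_ (cong (2 *_) (*-comm t s)) (+-comm (t * t) (s * s)) (ordered t s t≤s))
                ]′ (≤-total s t)
  where
  expand : ∀ s d → 2 * (s * (s + d)) + d * d ≡ s * s + (s + d) * (s + d)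
  expand = solve-∀
  ordered : ∀ s t → s ≤ t → 2 * (s * t) ≤ s * s + t * t
  ordered s t s≤t with d , refl ← m≤n⇒∃[o]m+o≡n s≤t =
    subst (2 * (s * (s + d)) ≤_) (expand s d) (m≤m+n _ (d * d))

module Triples {m} (good : Fin m → Fin m → Fin m → Bool)
  (good-sym : ∀ x y z → good x y z ≡ good y x z)
  (exclusive : ∀ x y z → x ≢ y → x ≢ z → y ≢ z → T (good x y z) → ¬ T (good x z y)) where

  bad : Fin m → Fin m → Fin m → Bool
  bad x y z = distinct x z ∧ distinct y z ∧ not (good x y z)

  badness : Fin m → Fin m → ℕ
  badness x y = ∑[ z < m ] 𝟙 (bad x y z)

  bad-sym : ∀ x y z → bad x y z ≡ bad y x z
  bad-sym x y z rewrite good-sym x y z with distinct x z | distinct y z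
  ... | false | false = refl
  ... | false | true  = refl
  ... | true  | false = refl
  ... | true  | true  = refl

  badness-sym : ∀ x y → badness x y ≡ badness y x
  badness-sym x y = sum-cong-≗ λ z → cong 𝟙 (bad-sym x y z)

  module _ (k : ℕ) where

    near : Fin m → Fin m → Bool
    near x y = distinct x y ∧ (badness x y <ᵇ k)

    near-sym : ∀ x y → near x y ≡ near y x
    near-sym x y = cong₂ (λ b n → b ∧ (n <ᵇ k)) (distinct-sym x y) (badness-sym x y)

    near-irrefl : ∀ x → near x x ≡ false
    near-irrefl x rewrite dec-true (x Fin.≟ x) refl = refl

    degree : Fin m → ℕ
    degree x = ∑[ y < m ] 𝟙 (near x y)

    -- A cherry is a path from `y` over `x` to `z`, and the sum over all triples includes the case
    -- `y ≡ z`. The second term of `charge` pays for these degenerate paths.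
    cherry charge : Fin m → Fin m → Fin m → ℕ
    cherry x y z = 2 * (𝟙 (near x y) * 𝟙 (near x z))
    charge x y z = 3 * (𝟙 (near x y) * 𝟙 (bad x y z)) + 2 * (𝟙 (near x y) * 𝟙 (does (y Fin.≟ z)))

    cherry-xyy : ∀ x y z → y ≡ z → cherry x y z ≤ charge x y z
    cherry-xyy x y z refl rewrite dec-true (y Fin.≟ y) refl with near x y
    ... | true  = m≤n⇒m≤o+n _ ≤-refl
    ... | false = z≤n

    cherry-xxz : ∀ x y z → x ≡ y → cherry x y z ≤ charge x y z
    cherry-xxz x y z refl rewrite near-irrefl x = z≤n

    cherry-xyx : ∀ x y z → x ≡ z → cherry x y z ≤ charge x y z
    cherry-xyx x y z refl rewrite near-irrefl x | *-zeroʳ (𝟙 (near x y)) = z≤n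

    bad-distinct : ∀ {x y z} → x ≢ z → y ≢ z → bad x y z ≡ not (good x y z)
    bad-distinct {x} {y} {z} x≢z y≢z rewrite dec-false (x Fin.≟ z) x≢z | dec-false (y Fin.≟ z) y≢z = refl

    -- Any two of the three pairs share a row, so after reordering by `good-sym` they contradict
    -- `exclusive`.
    at-most-one-good : ∀ {x y z} → x ≢ y → x ≢ z → y ≢ z →
      let e = good x y z; f = good y z x; g = good z x y
      in T (not (e ∧ f) ∧ not (f ∧ g) ∧ not (g ∧ e))
    at-most-one-good {x} {y} {z} x≢y x≢z y≢z
      with good x y z in e | good y z x in f | good z x y in g
    ... | true  | true  | _     = ⊥-elim (exclusive y x z (≢-sym x≢y) y≢z x≢z
                                    (subst T (sym (trans (good-sym y x z) e)) _) (subst T (sym f) _))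
    ... | true  | false | true  = ⊥-elim (exclusive x y z x≢y x≢z y≢z
                                    (subst T (sym e) _) (subst T (sym (trans (good-sym x z y) g)) _))
    ... | false | true  | true  = ⊥-elim (exclusive z x y (≢-sym x≢z) (≢-sym y≢z) x≢y
                                    (subst T (sym g) _) (subst T (sym (trans (good-sym z y x) f)) _))
    ... | true  | false | false = _
    ... | false | true  | false = _
    ... | false | false | true  = _
    ... | false | false | false = _

    -- In a triple of rows at most one of the three pairs is good, so a triple with g near pairs has
    -- at least g - 1 bad ones among them, while it contains 1 (g = 2) or 3 (g = 3) cherries.
    cherry≤charge : ∀ x y z →
      cherry x y z + (cherry y z x + cherry z x y) ≤ charge x y z + (charge y z x + charge z x y)
    cherry≤charge x y z = cases (x Fin.≟ y) (y Fin.≟ z) (z Fin.≟ x)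
      where
      open ≤-Reasoning
      p = 𝟙 (near x y)
      q = 𝟙 (near y z)
      s = 𝟙 (near z x)
      factor : ∀ c i j l → c * (i + (j + l)) ≡ c * i + (c * j + c * l)
      factor = solve-∀
      bound : ∀ x y z → x ≢ z → y ≢ z → 3 * (𝟙 (near x y) * 𝟙 (not (good x y z))) ≤ charge x y z
      bound x y z x≢z y≢z = subst (λ b → 3 * (𝟙 (near x y) * 𝟙 b) ≤ charge x y z) (bad-distinct x≢z y≢z) (m≤m+n _ _)
      cases : Dec (x ≡ y) → Dec (y ≡ z) → Dec (z ≡ x) →
        cherry x y z + (cherry y z x + cherry z x y) ≤ charge x y z + (charge y z x + charge z x y)
      cases (yes x≡y) _ _ =
        +-mono-≤ (cherry-xxz x y z x≡y) (+-mono-≤ (cherry-xyx y z x (sym x≡y)) (cherry-xyy z x y x≡y))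
      cases (no _) (yes y≡z) _ =
        +-mono-≤ (cherry-xyy x y z y≡z) (+-mono-≤ (cherry-xxz y z x y≡z) (cherry-xyx z x y (sym y≡z)))
      cases (no _) (no _) (yes z≡x) =
        +-mono-≤ (cherry-xyx x y z (sym z≡x)) (+-mono-≤ (cherry-xyy y z x z≡x) (cherry-xxz z x y z≡x))
      cases (no x≢y) (no y≢z) (no z≢x) = begin
        cherry x y z + (cherry y z x + cherry z x y)
          ≡⟨ cong₂ (λ b c → 2 * (p * 𝟙 b) + (2 * (q * 𝟙 c) + cherry z x y)) (near-sym x z) (near-sym y x) ⟩
        2 * (p * s) + (2 * (q * p) + 2 * (s * 𝟙 (near z y)))
          ≡⟨ cong (λ b → 2 * (p * s) + (2 * (q * p) + 2 * (s * 𝟙 b))) (near-sym z y) ⟩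
        2 * (p * s) + (2 * (q * p) + 2 * (s * q))
          ≡⟨ factor 2 (p * s) (q * p) (s * q) ⟨
        2 * (p * s + (q * p + s * q))
          ≤⟨ triangle-bound (near x y) (near y z) (near z x) _ _ _ (at-most-one-good x≢y (≢-sym z≢x) y≢z) ⟩
        3 * (p * 𝟙 (not (good x y z)) + (q * 𝟙 (not (good y z x)) + s * 𝟙 (not (good z x y))))
          ≡⟨ factor 3 (p * 𝟙 (not (good x y z))) (q * 𝟙 (not (good y z x))) (s * 𝟙 (not (good z x y))) ⟩
        3 * (p * 𝟙 (not (good x y z))) + (3 * (q * 𝟙 (not (good y z x))) + 3 * (s * 𝟙 (not (good z x y))))
          ≤⟨ +-mono-≤ (bound x y z (≢-sym z≢x) y≢z)
               (+-mono-≤ (bound y z x (≢-sym x≢y) z≢x) (bound z x y (≢-sym y≢z) x≢y)) ⟩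
        charge x y z + (charge y z x + charge z x y) ∎

    deficit : Fin m → Fin m → ℕ
    deficit x y = 𝟙 (distinct x y) * (k ∸ badness x y)

    -- On near pairs `k` splits as `(k ∸ b) + b`; on all others both sides vanish, by truncation
    -- when the badness is at least `k`.
    deficit-near : ∀ x y → 𝟙 (near x y) * k ≡ deficit x y + 𝟙 (near x y) * badness x y
    deficit-near x y with distinct x y | badness x y <ᵇ k in eq
    ... | false | _     = refl
    ... | true  | true  = trans (+-identityʳ k) (sym (trans (cong₂ _+_ (+-identityʳ (k ∸ badness x y)) (+-identityʳ (badness x y)))
                            (m∸n+n≡m (<⇒≤ (<ᵇ⇒< (badness x y) k (subst T (sym eq) _))))))
    ... | true  | false = sym (trans (+-identityʳ _) (trans (+-identityʳ _)
                            (m≤n⇒m∸n≡0 {k} {badness x y} (≮⇒≥ λ lt → subst T eq (<⇒<ᵇ {badness x y} {k} lt)))))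

    ∑cherry : ∑³ cherry ≡ ∑[ x < m ] (2 * (degree x * degree x))
    ∑cherry = sum-cong-≗ λ x → let d = degree x in begin
      ∑[ y < m ] ∑[ z < m ] (2 * (𝟙 (near x y) * 𝟙 (near x z)))
        ≡⟨ sum-cong-≗ (λ y → trans (sym (*-distribˡ-sum {m} 2 _)) (cong (2 *_) (sym (*-distribˡ-sum {m} (𝟙 (near x y)) _)))) ⟩
      ∑[ y < m ] (2 * (𝟙 (near x y) * d))  ≡⟨ *-distribˡ-sum {m} 2 (λ y → 𝟙 (near x y) * d) ⟨
      2 * (∑[ y < m ] (𝟙 (near x y) * d))  ≡⟨ cong (2 *_) (*-distribʳ-sum d (𝟙 ∘ near x)) ⟨
      2 * (d * d) ∎
      where open ≡-Reasoning

    ∑charge : ∀ x y → ∑[ z < m ] charge x y z ≡ 3 * (𝟙 (near x y) * badness x y) + 2 * 𝟙 (near x y)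
    ∑charge x y = let b = 𝟙 (near x y) in begin
      ∑[ z < m ] charge x y z
        ≡⟨ ∑-distrib-+ {m} (λ z → 3 * (b * 𝟙 (bad x y z))) _ ⟩
      ∑[ z < m ] (3 * (b * 𝟙 (bad x y z))) + ∑[ z < m ] (2 * (b * 𝟙 (does (y Fin.≟ z))))
        ≡⟨ cong₂ _+_ (pull 3 b (λ z → 𝟙 (bad x y z))) (pull 2 b (λ z → 𝟙 (does (y Fin.≟ z)))) ⟩
      3 * (b * badness x y) + 2 * (b * ∑[ z < m ] 𝟙 (does (y Fin.≟ z)))
        ≡⟨ cong (λ n → 3 * (b * badness x y) + 2 * n) (trans (cong (b *_) (sum-𝟙-≟ y)) (*-identityʳ b)) ⟩
      3 * (b * badness x y) + 2 * b ∎
      where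
      open ≡-Reasoning
      pull : ∀ c b (f : Fin m → ℕ) → ∑[ z < m ] (c * (b * f z)) ≡ c * (b * sum f)
      pull c b f = trans (sym (*-distribˡ-sum {m} c _)) (cong (c *_) (sym (*-distribˡ-sum b f)))

    ∑²-+ : (f g : Fin m → Fin m → ℕ) →
           ∑[ x < m ] ∑[ y < m ] (f x y + g x y) ≡ ∑[ x < m ] ∑[ y < m ] f x y + ∑[ x < m ] ∑[ y < m ] g x y
    ∑²-+ f g = trans (sum-cong-≗ λ x → ∑-distrib-+ (f x) (g x)) (∑-distrib-+ {m} _ _)

    -- Over ordered pairs `3 * Y + C` is `s` times the sum of the degrees d, while `C` is at least
    -- the sum of 2d². So `3 * Y` is at most the sum of sd - 2d², whose terms are at most s²/8.
    total-deficit≤ : 24 * ∑[ x < m ] ∑[ y < m ] deficit x y ≤ m * ((3 * k + 2) * (3 * k + 2))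
    total-deficit≤ = +-cancelʳ-≤ (8 * Q) _ _ (begin
      24 * Y + 8 * Q                                ≡⟨ regroup Y Q ⟩
      8 * (3 * Y + Q)                               ≤⟨ *-monoʳ-≤ 8 (+-monoʳ-≤ (3 * Y) counting) ⟩
      8 * (3 * Y + C)
        ≡⟨ cong (8 *_) (trans (cong (_+ C) 3Y) (sym (∑²-+ (λ x y → 3 * deficit x y) near-cost))) ⟩
      8 * (∑[ x < m ] ∑[ y < m ] (3 * deficit x y + near-cost x y))
        ≡⟨ cong (8 *_) (sum-cong-≗ λ x → trans (sum-cong-≗ (combine x)) (sym (*-distribˡ-sum s (𝟙 ∘ near x)))) ⟩
      8 * (∑[ x < m ] (s * degree x))                 ≡⟨ *-distribˡ-sum {m} 8 _ ⟩
      ∑[ x < m ] (8 * (s * degree x))                 ≤⟨ sum-mono (λ x → am-gm (degree x)) ⟩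
      ∑[ x < m ] (s * s + 8 * (2 * (degree x * degree x)))
        ≡⟨ ∑-distrib-+ {m} (λ _ → s * s) _ ⟩
      ∑[ x < m ] (s * s) + ∑[ x < m ] (8 * (2 * (degree x * degree x)))
        ≡⟨ cong₂ _+_ (sum-const m (s * s)) (sym (*-distribˡ-sum {m} 8 _)) ⟩
      m * (s * s) + 8 * Q                           ∎)
      where
      open ≤-Reasoning
      s = 3 * k + 2
      Y = ∑[ x < m ] ∑[ y < m ] deficit x y
      Q = ∑[ x < m ] (2 * (degree x * degree x))
      near-cost : Fin m → Fin m → ℕ
      near-cost x y = 3 * (𝟙 (near x y) * badness x y) + 2 * 𝟙 (near x y)
      C = ∑[ x < m ] ∑[ y < m ] near-cost x y
      counting : Q ≤ C
      counting = subst₂ _≤_ ∑cherry (sum-cong-≗ λ x → sum-cong-≗ (∑charge x)) (∑³-cyclic-≤ cherry≤charge)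
      3Y : 3 * Y ≡ ∑[ x < m ] ∑[ y < m ] (3 * deficit x y)
      3Y = trans (*-distribˡ-sum {m} 3 _) (sum-cong-≗ λ x → *-distribˡ-sum 3 (deficit x))
      regroup : ∀ Y Q → 24 * Y + 8 * Q ≡ 8 * (3 * Y + Q)
      regroup = solve-∀
      combine : ∀ x y → 3 * deficit x y + near-cost x y ≡ s * 𝟙 (near x y)
      combine x y = let b = 𝟙 (near x y); t = b * badness x y in
        trans (collect (deficit x y) t b) (trans (cong (λ n → 3 * n + 2 * b) (sym (deficit-near x y))) (expand b k))
        where
        collect : ∀ Y t b → 3 * Y + (3 * t + 2 * b) ≡ 3 * (Y + t) + 2 * b
        collect = solve-∀
        expand : ∀ b k → 3 * (b * k) + 2 * b ≡ (3 * k + 2) * b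
        expand = solve-∀
      -- The square of s - 4d is nonnegative.
      am-gm : ∀ d → 8 * (s * d) ≤ s * s + 8 * (2 * (d * d))
      am-gm d = subst₂ _≤_ (left s d) (right s d) (2st≤s²+t² s (4 * d))
        where
        left : ∀ s d → 2 * (s * (4 * d)) ≡ 8 * (s * d)
        left = solve-∀
        right : ∀ s d → s * s + 4 * d * (4 * d) ≡ s * s + 8 * (2 * (d * d))
        right = solve-∀

-- Truncated geometric averages

module Mixture (a : ℕ) where

  private R = suc a

  -- In closed form, the sum of `R ^ (N - k) * a ^ (k - 1) * φ k` over k from 1 to N.
  mix : (ℕ → ℕ) → ℕ → ℕ
  mix φ zero    = 0
  mix φ (suc N) = R * mix φ N + a ^ N * φ (suc N)

  -- Up to the factor R ^ N this is the mean of φ at the N-th truncation of a geometric variable with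
  -- success probability 1 / R, the tail being replaced by its mean.
  expect : (ℕ → ℕ) → ℕ → ℕ
  expect φ N = mix φ N + a ^ N * φ (suc N + a)

  expect-mono : ∀ {φ ψ} → (∀ k → φ k ≤ ψ k) → ∀ N → expect φ N ≤ expect ψ N
  expect-mono {φ} {ψ} φ≤ψ N = +-mono-≤ (mix-mono N) (*-monoʳ-≤ (a ^ N) (φ≤ψ (suc N + a)))
    where
    mix-mono : ∀ N → mix φ N ≤ mix ψ N
    mix-mono zero    = z≤n
    mix-mono (suc N) = +-mono-≤ (*-monoʳ-≤ R (mix-mono N)) (*-monoʳ-≤ (a ^ N) (φ≤ψ (suc N)))

  expect-* : ∀ c φ N → expect (λ k → c * φ k) N ≡ c * expect φ N
  expect-* c φ N = trans (cong (_+ a ^ N * (c * φ (suc N + a))) (mix-* N)) (pull c (mix φ N) (a ^ N) _)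
    where
    pull : ∀ c s t u → c * s + t * (c * u) ≡ c * (s + t * u)
    pull = solve-∀
    mix-* : ∀ N → mix (λ k → c * φ k) N ≡ c * mix φ N
    mix-* zero    = sym (*-zeroʳ c)
    mix-* (suc N) = trans (cong (λ s → R * s + a ^ N * (c * φ (suc N))) (mix-* N))
                          (pull′ R c (mix φ N) (a ^ N) (φ (suc N)))
      where
      pull′ : ∀ R c s t u → R * (c * s) + t * (c * u) ≡ c * (R * s + t * u)
      pull′ = solve-∀

  expect-+ : ∀ φ ψ N → expect (λ k → φ k + ψ k) N ≡ expect φ N + expect ψ N
  expect-+ φ ψ N = trans (cong (_+ a ^ N * (φ (suc N + a) + ψ (suc N + a))) (mix-+ N))
                         (interchange (mix φ N) (mix ψ N) (a ^ N) _ _)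
    where
    interchange : ∀ s t u v w → s + t + u * (v + w) ≡ s + u * v + (t + u * w)
    interchange = solve-∀
    mix-+ : ∀ N → mix (λ k → φ k + ψ k) N ≡ mix φ N + mix ψ N
    mix-+ zero    = refl
    mix-+ (suc N) = trans (cong (λ s → R * s + a ^ N * (φ (suc N) + ψ (suc N))) (mix-+ N))
                          (interchange′ R (mix φ N) (mix ψ N) (a ^ N) (φ (suc N)) (ψ (suc N)))
      where
      interchange′ : ∀ R s t u v w → R * (s + t) + u * (v + w) ≡ R * s + u * v + (R * t + u * w)
      interchange′ = solve-∀

  expect-∑ : ∀ {n} (φ : Fin n → ℕ → ℕ) N →
             expect (λ k → ∑[ i < n ] φ i k) N ≡ ∑[ i < n ] expect (φ i) N
  expect-∑ {zero}  φ N = trans (expect-* 0 (λ _ → 0) N) refl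
  expect-∑ {suc n} φ N = trans (expect-+ (φ zero) _ N) (cong (expect (φ zero) N +_) (expect-∑ (φ ∘ suc) N))

  mix-∸ : ∀ {N b} → N ≤ b → mix (_∸ b) N ≡ 0
  mix-∸ {zero}      N≤b = refl
  mix-∸ {suc N} {b} N<b rewrite mix-∸ {N} {b} (<⇒≤ N<b) | m≤n⇒m∸n≡0 N<b | *-zeroʳ R = *-zeroʳ (a ^ N)

  -- By convexity in b; the coefficients of the k ∸ b are the second differences of b ↦ R ^ (N + 1 - b) * a ^ b.
  expect-∸ : ∀ N g b → g + b ≡ suc N → expect (_∸ b) N ≡ R ^ g * a ^ b
  expect-∸ N zero .(suc N) refl = begin
    mix (_∸ suc N) N + a ^ N * (N + a ∸ N)
      ≡⟨ cong₂ (λ s t → s + a ^ N * t) (mix-∸ {N} (n≤1+n N)) (m+n∸m≡n N a) ⟩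
    a ^ N * a    ≡⟨ *-comm (a ^ N) a ⟩
    a * a ^ N    ≡⟨ +-identityʳ _ ⟨
    a * a ^ N + 0 ∎
    where open ≡-Reasoning
  expect-∸ zero (suc zero) zero refl = base a
    where
    base : ∀ a → 0 + 1 * suc a ≡ suc a * 1 * 1
    base = solve-∀
  expect-∸ zero (suc zero) (suc b) ()
  expect-∸ zero (suc (suc g)) b ()
  -- Here `g + b` is `N + 1`, so the truncated subtractions are exact and the step becomes a
  -- polynomial identity.
  expect-∸ (suc N) (suc g) b eq = begin
    R * mix (_∸ b) N + a ^ N * (suc N ∸ b) + a * a ^ N * (suc (suc N) + a ∸ b)
      ≡⟨ cong₂ (λ s t → R * mix (_∸ b) N + a ^ N * s + a * a ^ N * t) (reach N g b eq′)
           (reach (suc N + a) (suc g + a) b (trans (cong suc (shift g a b)) (cong (λ n → suc (n + a)) eq′))) ⟩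
    R * mix (_∸ b) N + a ^ N * g + a * a ^ N * (suc g + a)
      ≡⟨ step a (mix (_∸ b) N) (a ^ N) g ⟩
    R * (mix (_∸ b) N + a ^ N * (g + a))
      ≡⟨ cong (λ t → R * (mix (_∸ b) N + a ^ N * t)) (reach (N + a) (g + a) b (trans (shift g a b) (cong (_+ a) eq′))) ⟨
    R * expect (_∸ b) N  ≡⟨ cong (R *_) (expect-∸ N g b eq′) ⟩
    R * (R ^ g * a ^ b)  ≡⟨ *-assoc R (R ^ g) (a ^ b) ⟨
    R * R ^ g * a ^ b ∎
    where
    open ≡-Reasoning
    eq′ : g + b ≡ suc N
    eq′ = suc-injective eq
    reach : ∀ M h b → h + b ≡ suc M → suc M ∸ b ≡ h
    reach M h b h+b = trans (cong (_∸ b) (sym h+b)) (m+n∸n≡m h b)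
    shift : ∀ g a b → g + a + b ≡ g + b + a
    shift = solve-∀
    step : ∀ a V t g → suc a * V + t * g + a * t * (suc g + a) ≡ suc a * (V + t * (g + a))
    step = solve-∀

  -- A geometric variable with success probability 1/R has mean R and variance R² - R, so (3k + 2)²
  -- has mean 18R² + 3R + 4. The correction is 9 times the variance lost in the tail, scaled by
  -- `R ^ N`.
  expect-square : ∀ N → expect (λ k → (3 * k + 2) * (3 * k + 2)) N + 9 * (R * (a * a ^ N)) ≡
                        R ^ N * (18 * (R * R) + 3 * R + 4)
  expect-square zero    = base a
    where
    base : ∀ a → 1 * ((3 * suc a + 2) * (3 * suc a + 2)) + 9 * (suc a * (a * 1)) ≡
                 1 * (18 * (suc a * suc a) + 3 * suc a + 4)
    base = solve-∀
  expect-square (suc N) = trans (step a N (mix _ N) (a ^ N))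
    (trans (cong (R *_) (expect-square N)) (sym (*-assoc R (R ^ N) _)))
    where
    step : ∀ a N V t →
      (suc a * V + t * ((3 * suc N + 2) * (3 * suc N + 2)))
      + a * t * ((3 * (suc (suc N) + a) + 2) * (3 * (suc (suc N) + a) + 2)) + 9 * (suc a * (a * (a * t)))
      ≡ suc a * (V + t * ((3 * (suc N + a) + 2) * (3 * (suc N + a) + 2)) + 9 * (suc a * (a * t)))
    step = solve-∀

  expect-square-≤ : 1 ≤ a → ∀ N → 4 * expect (λ k → (3 * k + 2) * (3 * k + 2)) N ≤ 83 * R ^ (2 + N)
  expect-square-≤ 1≤a N = begin
    4 * E                                     ≤⟨ *-monoʳ-≤ 4 (≤-trans (m≤m+n E _) (≤-reflexive (expect-square N))) ⟩
    4 * (R ^ N * (18 * (R * R) + 3 * R + 4))           ≡⟨ swap 4 (R ^ N) _ ⟩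
    R ^ N * (4 * (18 * (R * R) + 3 * R + 4))           ≤⟨ *-monoʳ-≤ (R ^ N) numeric ⟩
    R ^ N * (83 * (R * R))                             ≡⟨ collect (R ^ N) R ⟩
    83 * R ^ (2 + N)                                   ∎
    where
    open ≤-Reasoning
    E = expect (λ k → (3 * k + 2) * (3 * k + 2)) N
    swap : ∀ c s t → c * (s * t) ≡ s * (c * t)
    swap = solve-∀
    collect : ∀ t R → t * (83 * (R * R)) ≡ 83 * (R * (R * t))
    collect = solve-∀
    numeric : 4 * (18 * (R * R) + 3 * R + 4) ≤ 83 * (R * R)
    -- Writing `R` as `2 + b` makes the gap a polynomial in `b` with nonnegative coefficients.
    numeric with b , refl ← m≤n⇒∃[o]m+o≡n 1≤a =
      subst (4 * (18 * (R * R) + 3 * R + 4) ≤_) (excess b) (m≤m+n _ (11 * b * b + 32 * b + 4))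
      where
      excess : ∀ b → 4 * (18 * ((2 + b) * (2 + b)) + 3 * (2 + b) + 4) + (11 * b * b + 32 * b + 4) ≡
                     83 * ((2 + b) * (2 + b))
      excess = solve-∀

-- Covering the compressed family by boxes

product-𝟙≤ : ∀ {n c} (p : Fin n → Bool) → ((∀ i → T (p i)) → 1 ≤ c) → product (𝟙 ∘ p) ≤ c
product-𝟙≤ {zero}  p all = all λ ()
product-𝟙≤ {suc n} p all with p zero in eq
... | false = z≤n
... | true  = subst (_≤ _) (sym (+-identityʳ _))
                (product-𝟙≤ (p ∘ suc) λ ps → all λ { zero → subst T (sym eq) _ ; (suc i) → ps i })

-- Columns of a simple matrix as a set of words

module _ {m n r} (A : Matrix m n r) where

  column? : ∀ w → Dec (∃ λ j → ∀ i → A i j ≡ lookup w i)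
  column? w = Fin.any? λ j → Fin.all? λ i → A i j Fin.≟ lookup w i

  isColumn : Vec (Fin r) m → Bool
  isColumn w = does (column? w)

  -- The indicator that column `j` spells `w`, as a product over the rows so that its sum over words
  -- factors.
  hit : Fin n → Vec (Fin r) m → ℕ
  hit j w = product (λ i → 𝟙 (does (A i j Fin.≟ lookup w i)))

  hit≤ : ∀ {c} j w → ((∀ i → A i j ≡ lookup w i) → 1 ≤ c) → hit j w ≤ c
  hit≤ j w match = product-𝟙≤ (λ i → does (A i j Fin.≟ lookup w i))
    λ t → match λ i → toWitness′ (A i j Fin.≟ lookup w i) (t i)
    where
    toWitness′ : {P : Set} (P? : Dec P) → T (does P?) → P
    toWitness′ (yes p) _ = p

  sumW-hit : ∀ j → sumW (hit j) ≡ 1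
  sumW-hit j = trans (sumW-product {r} λ i s → 𝟙 (does (A i j Fin.≟ s)))
                     (product≡1 λ i → sum-𝟙-≟ (A i j))

  ∑hit≤ : Simple A → ∀ w → ∑[ j < n ] hit j w ≤ 𝟙 (isColumn w)
  ∑hit≤ simple w with column? w
  ... | yes (j₀ , eq₀) = begin
    ∑[ j < n ] hit j w                ≤⟨ sum-mono (λ j → hit≤ j w λ eq →
                                           ≤-reflexive (sym (cong 𝟙 (dec-true (j₀ Fin.≟ j) (simple j₀ j λ i → trans (eq₀ i) (sym (eq i))))))) ⟩
    ∑[ j < n ] 𝟙 (does (j₀ Fin.≟ j))  ≡⟨ sum-𝟙-≟ j₀ ⟩
    1                                 ∎
    where open ≤-Reasoning
  ... | no ∄j = subst (∑[ j < n ] hit j w ≤_) (sum-replicate-zero n)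
    (sum-mono λ j → hit≤ j w λ eq → contradiction (j , eq) ∄j)

  -- Double counting of columns and the words they spell: each column spells one word, and in a
  -- simple matrix no word is spelt twice.
  columns≤size : Simple A → n ≤ sumW (𝟙 ∘ isColumn)
  columns≤size simple = begin
    n                                    ≡⟨ trans (sym (*-identityʳ n)) (sym (sum-const n 1)) ⟩
    ∑[ j < n ] 1                         ≡⟨ sum-cong-≗ sumW-hit ⟨
    ∑[ j < n ] sumW (hit j)              ≡⟨ sumW-∑ hit ⟨
    sumW (λ w → ∑[ j < n ] hit j w)      ≤⟨ sumW-mono (∑hit≤ simple) ⟩
    sumW (𝟙 ∘ isColumn)                  ∎
    where open ≤-Reasoning

isColumn-avoids : ∀ {m n a} (A : Matrix m n (2 + a)) → ¬ ContainsConfig A M → Avoids {a} (isColumn A)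
isColumn-avoids {m} {n} A ∌M u v {x} {y} {z} u∈ v∈ x≢y x≢z y≢z (ux , uy , uz) (vx , vy , vz)
  with column? A u | column? A v
... | yes (j , Aj) | yes (k , Ak) = ∌M (ρ , γ , ρ-injective , γ-injective , entries)
  where
  ρ : Fin 3 → Fin m
  ρ zero             = x
  ρ (suc zero)       = y
  ρ (suc (suc zero)) = z
  γ : Fin 2 → Fin n
  γ zero       = j
  γ (suc zero) = k
  ρ-injective : Injective _≡_ _≡_ ρ
  ρ-injective {zero}         {zero}         _ = refl
  ρ-injective {zero}         {suc zero}     e = contradiction e x≢y
  ρ-injective {zero}         {suc (suc zero)} e = contradiction e x≢z
  ρ-injective {suc zero}     {zero}         e = contradiction (sym e) x≢y
  ρ-injective {suc zero}     {suc zero}     _ = refl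
  ρ-injective {suc zero}     {suc (suc zero)} e = contradiction e y≢z
  ρ-injective {suc (suc zero)} {zero}       e = contradiction (sym e) x≢z
  ρ-injective {suc (suc zero)} {suc zero}   e = contradiction (sym e) y≢z
  ρ-injective {suc (suc zero)} {suc (suc zero)} _ = refl
  j≢k : j ≢ k
  -- Row `x` holds 0 in column `j` and 1 in column `k`.
  j≢k refl with () ← trans (sym (trans (Aj x) ux)) (trans (Ak x) vx)
  γ-injective : Injective _≡_ _≡_ γ
  γ-injective {zero}     {zero}     _ = refl
  γ-injective {zero}     {suc zero} e = contradiction e j≢k
  γ-injective {suc zero} {zero}     e = contradiction (sym e) j≢k
  γ-injective {suc zero} {suc zero} _ = refl
  entries : ∀ p q → toℕ (A (ρ p) (γ q)) ≡ M p q
  entries zero             zero       = cong toℕ (trans (Aj x) ux)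
  entries zero             (suc zero) = cong toℕ (trans (Ak x) vx)
  entries (suc zero)       zero       = cong toℕ (trans (Aj y) uy)
  entries (suc zero)       (suc zero) = cong toℕ (trans (Ak y) vy)
  entries (suc (suc zero)) zero       = cong toℕ (trans (Aj z) uz)
  entries (suc (suc zero)) (suc zero) = cong toℕ (trans (Ak z) vz)

-- Boxes of words and their sizes

module Boxes (a : ℕ) where

  isOne notOne aboveOne : Fin (2 + a) → ℕ
  isOne (suc zero) = 1
  isOne _          = 0
  notOne (suc zero) = 0
  notOne _          = 1
  aboveOne (suc (suc _)) = 1
  aboveOne _             = 0

  ∑isOne : sum isOne ≡ 1
  ∑isOne = cong suc (sum-replicate-zero a)

  ∑aboveOne : sum aboveOne ≡ a
  ∑aboveOne = trans (sum-const a 1) (*-identityʳ a)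

  ∑notOne : sum notOne ≡ suc a
  ∑notOne = cong suc ∑aboveOne

  notOne≡1 : ∀ {s} → s ≢ suc zero → notOne s ≡ 1
  notOne≡1 {zero}        s≢1 = refl
  notOne≡1 {suc zero}    s≢1 = contradiction refl s≢1
  notOne≡1 {suc (suc s)} s≢1 = refl

  aboveOne≡1 : ∀ {s} → s ≢ zero → s ≢ suc zero → aboveOne s ≡ 1
  aboveOne≡1 {zero}        s≢0 s≢1 = contradiction refl s≢0
  aboveOne≡1 {suc zero}    s≢0 s≢1 = contradiction refl s≢1
  aboveOne≡1 {suc (suc s)} s≢0 s≢1 = refl

  -- p and q mark the two rows carrying a 1, and e the rows where 0 is allowed.
  slot : (p q e : Bool) → Fin (2 + a) → ℕ
  slot true  q     e     = isOne
  slot false true  e     = isOne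
  slot false false true  = notOne
  slot false false false = aboveOne

  width : (p q e : Bool) → ℕ
  width true  q     e     = 1
  width false true  e     = 1
  width false false true  = suc a
  width false false false = a

  ∑slot : ∀ p q e → sum (slot p q e) ≡ width p q e
  ∑slot true  q     e     = ∑isOne
  ∑slot false true  e     = ∑isOne
  ∑slot false false true  = ∑notOne
  ∑slot false false false = ∑aboveOne

  product-width : ∀ {n} (p q e : Fin n → Bool) →
    product (λ z → width (p z) (q z) (e z)) ≡
    suc a ^ (∑[ z < n ] 𝟙 (not (p z) ∧ not (q z) ∧ e z)) * a ^ (∑[ z < n ] 𝟙 (not (p z) ∧ not (q z) ∧ not (e z)))
  product-width {zero}  p q e = refl
  product-width {suc n} p q e = width-* (p zero) (q zero) (e zero) (product-width (p ∘ suc) (q ∘ suc) (e ∘ suc))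
    where
    swap : ∀ c s t → c * (s * t) ≡ s * (c * t)
    swap = solve-∀
    width-* : ∀ p q e {s G B} → s ≡ suc a ^ G * a ^ B → width p q e * s ≡
      suc a ^ (𝟙 (not p ∧ not q ∧ e) + G) * a ^ (𝟙 (not p ∧ not q ∧ not e) + B)
    width-* true  q     e     eq = trans (+-identityʳ _) eq
    width-* false true  e     eq = trans (+-identityʳ _) eq
    width-* false false true  {G = G} {B} eq = trans (cong (suc a *_) eq) (sym (*-assoc (suc a) (suc a ^ G) (a ^ B)))
    width-* false false false {G = G} {B} eq = trans (cong (a *_) eq) (swap a (suc a ^ G) (a ^ B))

  none : ∀ {m} → Vec (Fin (2 + a)) m → ℕ
  none ω = product (λ z → notOne (lookup ω z))

  single : ∀ {m} → Fin m → Vec (Fin (2 + a)) m → ℕ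
  single x ω = product (λ z → (if does (x Fin.≟ z) then isOne else notOne) (lookup ω z))

  sumW-none : ∀ m → sumW {m = m} none ≡ suc a ^ m
  sumW-none m = trans (sumW-product {m = m} λ _ → notOne)
    (trans (product-cong {m} λ _ → ∑notOne) (product-const m (suc a)))

  sumW-single : ∀ {m} (x : Fin (suc m)) → sumW (single x) ≡ suc a ^ m
  sumW-single {m} x = trans (sumW-product λ z → if does (x Fin.≟ z) then isOne else notOne)
    (trans (product-cong λ z → factor (does (x Fin.≟ z))) (product-single (suc a) x))
    where
    factor : ∀ b → sum (if b then isOne else notOne) ≡ (if b then 1 else suc a)
    factor true  = ∑isOne
    factor false = ∑notOne

-- The cover of a compressed family

module Bound {a m : ℕ} (χ : Vec (Fin (2 + a)) m → Bool) (avoids : Avoids χ) where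

  open Boxes a
  private R = suc a

  good? : ∀ x y z → Dec (Good avoids x y z)
  good? x y z = any-word? λ ω → T? (compress χ ω) ×-dec (lookup ω x Fin.≟ suc zero)
                  ×-dec (lookup ω y Fin.≟ suc zero) ×-dec (lookup ω z Fin.≟ zero)

  good : Fin m → Fin m → Fin m → Bool
  good x y z = does (good? x y z)

  good⇒Good : ∀ {x y z} → T (good x y z) → Good avoids x y z
  good⇒Good {x} {y} {z} t with good? x y z
  ... | yes g = g

  open Triples good
    (λ x y z → does-⇔ (mk⇔ (Good-sym avoids) (Good-sym avoids)) (good? x y z) (good? y x z))
    (λ x y z x≢y x≢z y≢z g h → Good-exclusive avoids x≢y x≢z y≢z (good⇒Good g) (good⇒Good h))

  double : Fin m → Fin m → Vec (Fin (2 + a)) m → ℕ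
  double x y ω = product (λ z → slot (does (x Fin.≟ z)) (does (y Fin.≟ z)) (good x y z) (lookup ω z))

  volume : Fin m → Fin m → ℕ
  volume x y = product (λ z → width (does (x Fin.≟ z)) (does (y Fin.≟ z)) (good x y z))

  doubles : ℕ
  doubles = ∑[ x < m ] ∑[ y < m ] (𝟙 (distinct x y) * volume x y)

  sumW-double : ∀ x y → sumW (double x y) ≡ volume x y
  sumW-double x y =
    trans (sumW-product λ z → slot (does (x Fin.≟ z)) (does (y Fin.≟ z)) (good x y z))
          (product-cong λ z → ∑slot (does (x Fin.≟ z)) (does (y Fin.≟ z)) (good x y z))

  singleAny doubleAny cover : Vec (Fin (2 + a)) m → ℕ
  singleAny ω = ∑[ x < m ] single x ω
  doubleAny ω = ∑[ x < m ] ∑[ y < m ] (𝟙 (distinct x y) * double x y ω)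
  -- The pair of rows of a word with two 1s is counted twice in doubleAny, which explains the factors 2.
  cover ω = 2 * none ω + (2 * singleAny ω + doubleAny ω)

  one? : ∀ (ω : Vec (Fin (2 + a)) m) x → Dec (lookup ω x ≡ suc zero)
  one? ω x = lookup ω x Fin.≟ suc zero

  none≡1 : ∀ ω → (∀ x → lookup ω x ≢ suc zero) → none ω ≡ 1
  none≡1 ω ≢1 = product≡1 {m} λ z → notOne≡1 (≢1 z)

  single≡1 : ∀ ω x → lookup ω x ≡ suc zero → (∀ z → x ≢ z → lookup ω z ≢ suc zero) → single x ω ≡ 1
  single≡1 ω x ωx ≢1 = product≡1 {m} at
    where
    at : ∀ z → (if does (x Fin.≟ z) then isOne else notOne) (lookup ω z) ≡ 1
    at z with x Fin.≟ z
    ... | yes refl = cong isOne ωx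
    ... | no x≢z   = notOne≡1 (≢1 z x≢z)

  -- A third 1 is excluded by shattering, and any row where `ω` is 0 is good with `ω` itself as
  -- witness.
  double≡1 : ∀ ω {x y} → T (compress χ ω) → x ≢ y →
    lookup ω x ≡ suc zero → lookup ω y ≡ suc zero → double x y ω ≡ 1
  double≡1 ω {x} {y} p x≢y ωx ωy = product≡1 {m} at
    where
    at : ∀ z → slot (does (x Fin.≟ z)) (does (y Fin.≟ z)) (good x y z) (lookup ω z) ≡ 1
    at z with x Fin.≟ z | y Fin.≟ z | good? x y z
    ... | yes refl | _        | _     = cong isOne ωx
    ... | no _     | yes refl | _     = cong isOne ωy
    ... | no x≢z   | no y≢z   | yes _ = notOne≡1 (no-three-ones {χ = χ} avoids {ω = ω} p x≢y x≢z y≢z ωx ωy)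
    ... | no x≢z   | no y≢z   | no ¬g =
      aboveOne≡1 (λ ωz → ¬g (ω , p , ωx , ωy , ωz)) (no-three-ones {χ = χ} avoids {ω = ω} p x≢y x≢z y≢z ωx ωy)

  -- A compressed word has no 1, exactly one, or at least two, and lies in a box of the matching
  -- kind.
  covered : ∀ ω → 2 * 𝟙 (compress χ ω) ≤ cover ω
  covered ω with compress χ ω in eq
  ... | false = z≤n
  ... | true with Fin.any? (one? ω)
  ...   | no ∄x = m≤n⇒m≤n+o (2 * singleAny ω + doubleAny ω) (≤-reflexive (cong (2 *_) (sym (none≡1 ω λ x ωx → ∄x (x , ωx)))))
  ...   | yes (x , ωx) with Fin.any? (λ y → ¬? (x Fin.≟ y) ×-dec one? ω y)
  ...     | no ∄y = m≤n⇒m≤o+n (2 * none ω) (m≤n⇒m≤n+o (doubleAny ω) (*-monoʳ-≤ 2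
                      (≤-trans (≤-reflexive (sym (single≡1 ω x ωx λ z x≢z ωz → ∄y (z , x≢z , ωz))))
                               (term≤sum (λ x → single x ω) x))))
  -- Both orders of the pair contribute, in the separate summands for `x` and `y`, which gives the
  -- required 2.
  ...     | yes (y , x≢y , ωy) = m≤n⇒m≤o+n (2 * none ω) (m≤n⇒m≤o+n (2 * singleAny ω)
      (≤-trans (+-mono-≤ (row x≢y ωx ωy) (row (≢-sym x≢y) ωy ωx)) (two-terms≤sum (λ x → ∑[ y < m ] f x y) x≢y)))
    where
    f : Fin m → Fin m → ℕ
    f x y = 𝟙 (distinct x y) * double x y ω
    row : ∀ {x y} → x ≢ y → lookup ω x ≡ suc zero → lookup ω y ≡ suc zero → 1 ≤ ∑[ y < m ] f x y
    row {x} {y} x≢y ωx ωy = ≤-trans (≤-reflexive (sym f≡1)) (term≤sum (f x) y)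
      where
      f≡1 : f x y ≡ 1
      f≡1 rewrite dec-false (x Fin.≟ y) x≢y =
        trans (+-identityʳ _) (double≡1 ω (subst T (sym eq) _) x≢y ωx ωy)

  sumW-singleAny : sumW singleAny ≡ m * R ^ (m ∸ 1)
  sumW-singleAny = trans (sumW-∑ (single {m})) (∑single m)
    where
    ∑single : ∀ m → ∑[ x < m ] sumW (single x) ≡ m * R ^ (m ∸ 1)
    ∑single zero    = refl
    ∑single (suc m) = trans (sum-cong-≗ (sumW-single {m})) (sum-const (suc m) (R ^ m))

  sumW-doubleAny : sumW doubleAny ≡ doubles
  sumW-doubleAny = trans (sumW-∑ λ x ω → ∑[ y < m ] (𝟙 (distinct x y) * double x y ω)) (sum-cong-≗ λ x →
    trans (sumW-∑ λ y ω → 𝟙 (distinct x y) * double x y ω) (sum-cong-≗ λ y →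
      trans (sumW-* (𝟙 (distinct x y)) (double x y)) (cong (𝟙 (distinct x y) *_) (sumW-double x y))))

  sumW-cover : sumW cover ≡ 2 * R ^ m + (2 * (m * R ^ (m ∸ 1)) + doubles)
  sumW-cover = begin
    sumW cover
      ≡⟨ sumW-+ {m = m} (λ ω → 2 * none ω) (λ ω → 2 * singleAny ω + doubleAny ω) ⟩
    sumW (λ ω → 2 * none {m} ω) + sumW (λ ω → 2 * singleAny ω + doubleAny ω)
      ≡⟨ cong₂ _+_ (sumW-* {m = m} 2 none) (sumW-+ (λ ω → 2 * singleAny ω) doubleAny) ⟩
    2 * sumW {m = m} none + (sumW (λ ω → 2 * singleAny ω) + sumW doubleAny)
      ≡⟨ cong₂ (λ s t → 2 * s + (t + sumW doubleAny)) (sumW-none m) (sumW-* 2 singleAny) ⟩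
    2 * R ^ m + (2 * sumW singleAny + sumW doubleAny)
      ≡⟨ cong₂ (λ s t → 2 * R ^ m + (2 * s + t)) sumW-singleAny sumW-doubleAny ⟩
    2 * R ^ m + (2 * (m * R ^ (m ∸ 1)) + doubles) ∎
    where open ≡-Reasoning

  2*size≤ : 2 * sumW (𝟙 ∘ χ) ≤ 2 * R ^ m + (2 * (m * R ^ (m ∸ 1)) + doubles)
  2*size≤ = begin
    2 * sumW (𝟙 ∘ χ)                       ≡⟨ cong (2 *_) (size-compress χ) ⟨
    2 * sumW (𝟙 ∘ compress χ)              ≡⟨ sumW-* 2 (𝟙 ∘ compress χ) ⟨
    sumW (λ ω → 2 * 𝟙 (compress χ ω))      ≤⟨ sumW-mono covered ⟩
    sumW cover                             ≡⟨ sumW-cover ⟩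
    2 * R ^ m + (2 * (m * R ^ (m ∸ 1)) + doubles) ∎
    where open ≤-Reasoning

  -- Averaging over the thresholds

  open Mixture a

  goodness : Fin m → Fin m → ℕ
  goodness x y = ∑[ z < m ] 𝟙 (distinct x z ∧ distinct y z ∧ good x y z)

  volume-power : ∀ x y → volume x y ≡ R ^ goodness x y * a ^ badness x y
  volume-power x y = product-width (λ z → does (x Fin.≟ z)) (λ z → does (y Fin.≟ z)) (good x y)

  -- Every row is exactly one of `x`, `y`, good or bad.
  goodness+badness : ∀ {x y} → x ≢ y → 2 + (goodness x y + badness x y) ≡ m
  goodness+badness {x} {y} x≢y = begin
    2 + (goodness x y + badness x y)
      ≡⟨ cong₂ _+_ (cong₂ _+_ (sum-𝟙-≟ x) (sum-𝟙-≟ y)) (∑-distrib-+ {m} g b) ⟨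
    sum (λ z → 𝟙 (does (x Fin.≟ z))) + sum (λ z → 𝟙 (does (y Fin.≟ z))) + sum (λ z → g z + b z)
      ≡⟨ cong (_+ sum (λ z → g z + b z)) (∑-distrib-+ {m} _ _) ⟨
    sum (λ z → 𝟙 (does (x Fin.≟ z)) + 𝟙 (does (y Fin.≟ z))) + sum (λ z → g z + b z)
      ≡⟨ ∑-distrib-+ {m} _ _ ⟨
    sum (λ z → 𝟙 (does (x Fin.≟ z)) + 𝟙 (does (y Fin.≟ z)) + (g z + b z))
      ≡⟨ sum-cong-≗ at ⟩
    ∑[ z < m ] 1 ≡⟨ trans (sum-const m 1) (*-identityʳ m) ⟩
    m ∎
    where
    open ≡-Reasoning
    g b : Fin m → ℕ
    g z = 𝟙 (distinct x z ∧ distinct y z ∧ good x y z)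
    b z = 𝟙 (bad x y z)
    at : ∀ z → 𝟙 (does (x Fin.≟ z)) + 𝟙 (does (y Fin.≟ z)) + (g z + b z) ≡ 1
    at z with x Fin.≟ z | y Fin.≟ z | good x y z
    ... | yes refl | yes refl | _     = contradiction refl x≢y
    ... | yes _    | no _     | _     = refl
    ... | no _     | yes _    | _     = refl
    ... | no _     | no _     | true  = refl
    ... | no _     | no _     | false = refl

  -- Each volume is `R ^ g * a ^ b` with `g + b` equal to `N + 1`, hence the average of `_∸ b`;
  -- linearity moves the average outside the sums over pairs.
  doubles-expect : ∀ {N} → m ≡ 3 + N → doubles ≡ expect (λ k → ∑[ x < m ] ∑[ y < m ] deficit k x y) N
  doubles-expect {N} m≡3+N = sym (trans (expect-∑ (λ x k → ∑[ y < m ] deficit k x y) N) (sum-cong-≗ λ x →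
    trans (expect-∑ (λ y k → deficit k x y) N) (sum-cong-≗ λ y →
      trans (expect-* (𝟙 (distinct x y)) (_∸ badness x y) N) (at x y))))
    where
    at : ∀ x y → 𝟙 (distinct x y) * expect (_∸ badness x y) N ≡ 𝟙 (distinct x y) * volume x y
    at x y = cases (x Fin.≟ y)
      where
      cases : (x≟y : Dec (x ≡ y)) → 𝟙 (not (does x≟y)) * expect (_∸ badness x y) N ≡ 𝟙 (not (does x≟y)) * volume x y
      cases (yes _)  = refl
      cases (no x≢y) = cong (1 *_) (trans
        (expect-∸ N (goodness x y) (badness x y) (suc-injective (suc-injective (trans (goodness+badness x≢y) m≡3+N))))
        (sym (volume-power x y)))

  -- The factor 96 is 24 from `total-deficit≤`, applied at every `k`, times 4 from
  -- `expect-square-≤`.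
  96*doubles≤ : ∀ N → 1 ≤ a → m ≡ 3 + N → 96 * doubles ≤ 83 * (m * R ^ (m ∸ 1))
  96*doubles≤ N 1≤a m≡3+N = begin
    96 * doubles                           ≡⟨ *-assoc 4 24 doubles ⟩
    4 * (24 * doubles)                     ≡⟨ cong (λ d → 4 * (24 * d)) (doubles-expect m≡3+N) ⟩
    4 * (24 * expect D N)                  ≡⟨ cong (4 *_) (expect-* 24 D N) ⟨
    4 * expect (λ k → 24 * D k) N          ≤⟨ *-monoʳ-≤ 4 (expect-mono total-deficit≤ N) ⟩
    4 * expect (λ k → m * square k) N      ≡⟨ cong (4 *_) (expect-* m square N) ⟩
    4 * (m * expect square N)              ≡⟨ swap 4 m _ ⟩
    m * (4 * expect square N)              ≤⟨ *-monoʳ-≤ m (expect-square-≤ 1≤a N) ⟩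
    m * (83 * R ^ (2 + N))                 ≡⟨ cong (λ e → m * (83 * R ^ (e ∸ 1))) m≡3+N ⟨
    m * (83 * R ^ (m ∸ 1))                 ≡⟨ swap m 83 _ ⟩
    83 * (m * R ^ (m ∸ 1))                 ∎
    where
    open ≤-Reasoning
    D square : ℕ → ℕ
    D k = ∑[ x < m ] ∑[ y < m ] deficit k x y
    square k = (3 * k + 2) * (3 * k + 2)
    swap : ∀ c s t → c * (s * t) ≡ s * (c * t)
    swap = solve-∀

-- Few rows and the final count

doubles-bound : ∀ {a m} (χ : Vec (Fin (2 + a)) m → Bool) (avoids : Avoids χ) → 1 ≤ a →
                96 * Bound.doubles χ avoids ≤ 83 * (m * suc a ^ (m ∸ 1))
doubles-bound {a} {m} χ avoids 1≤a = by-rows m refl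
  where
  -- There is no third row, so each of the two ordered pairs has volume 1.
  doubles≡2 : (χ : Vec (Fin (2 + a)) 2 → Bool) (avoids : Avoids χ) → Bound.doubles χ avoids ≡ 2
  doubles≡2 χ avoids = refl
  two-rows : ∀ {a} → 1 ≤ a → 192 ≤ 83 * (2 * (suc a * 1))
  two-rows {suc b} (s≤s z≤n) = subst (192 ≤_) (slack b) (m≤m+n 192 _)
    where
    slack : ∀ b → 192 + (140 + 166 * b) ≡ 83 * (2 * ((2 + b) * 1))
    slack = solve-∀
  -- Matching m against 3 + N would unfold the sums over the rows, hence the equation.
  by-rows : ∀ k → m ≡ k → 96 * Bound.doubles χ avoids ≤ 83 * (m * suc a ^ (m ∸ 1))
  by-rows zero                refl = z≤n
  by-rows (suc zero)          refl = z≤n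
  by-rows (suc (suc zero))    refl = ≤-trans (≤-reflexive (cong (96 *_) (doubles≡2 χ avoids))) (two-rows {a} 1≤a)
  by-rows (suc (suc (suc N))) m≡3+N = Bound.96*doubles≤ χ avoids N 1≤a m≡3+N

theorem1p7 : (m r : ℕ) → 3 ≤ r → (n : ℕ) → (A : Matrix m n r) →
    Simple A → ¬ ContainsConfig A M →
    192 * n ≤ 275 * m * (r ∸ 1) ^ (m ∸ 1) + 192 * (r ∸ 1) ^ m
-- Matching writes `r` as `2 + a` with `a` at least 1, so `suc a` is `r - 1`.
theorem1p7 m (suc (suc a)) (s≤s (s≤s 1≤a)) n A simple ∌M = begin
  192 * n                        ≤⟨ *-monoʳ-≤ 192 (columns≤size A simple) ⟩
  192 * S                        ≡⟨ *-assoc 96 2 S ⟩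
  96 * (2 * S)                   ≤⟨ *-monoʳ-≤ 96 (Bound.2*size≤ χ avoids) ⟩
  96 * (2 * p + (2 * q + d))     ≡⟨ expand p q d ⟩
  192 * p + 192 * q + 96 * d     ≤⟨ +-monoʳ-≤ (192 * p + 192 * q) (doubles-bound χ avoids 1≤a) ⟩
  -- The coefficient 275 is 192 from the words with one 1 plus 83 from those with two.
  192 * p + 192 * q + 83 * q     ≡⟨ collect p m (suc a ^ (m ∸ 1)) ⟩
  275 * m * suc a ^ (m ∸ 1) + 192 * p ∎
  where
  open ≤-Reasoning
  χ = isColumn A
  avoids : Avoids χ
  avoids = isColumn-avoids A ∌M
  S = sumW (𝟙 ∘ χ)
  p = suc a ^ m
  q = m * suc a ^ (m ∸ 1)
  d = Bound.doubles χ avoids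
  expand : ∀ p q d → 96 * (2 * p + (2 * q + d)) ≡ 192 * p + 192 * q + 96 * d
  expand = solve-∀
  collect : ∀ p m t → 192 * p + 192 * (m * t) + 83 * (m * t) ≡ 275 * m * t + 192 * p
  collect = solve-∀
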